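{- Let $p$ be a prime number. Then: (i) $D(\Gamma(\mathbb{Z}_{p^2}),x)=(1+x)^{p-1}-1$; (ii) $D_t(\Gamma(\mathbb{Z}_{p^2}),x)=(1+x)^{p-1}-(p-1)x-1$.
   Context: For a positive integer $n$, the zero-divisor graph $\Gamma(\mathbb{Z}_n)$ is the simple undirected loopless graph whose vertices are the nonzero zero-divisors of the ring $\mathbb{Z}_n$ of integers modulo $n$, two distinct vertices $u,v$ being adjacent if and only if $uv=0$ in $\mathbb{Z}_n$. For a finite simple graph $G$ with vertex set $V$, a set $S\subseteq V$ is a dominating set if every vertex of $V\setminus S$ is adjacent to at least one vertex of $S$; it is a total dominating set if every vertex of $V$ is adjacent to at least one vertex of $S$. Let $d(G,i)$ (resp. $d_t(G,i)$) be the number of dominating sets (resp. total dominating sets) of $G$ of cardinality $i$. The domination polynomial is $D(G,x)=\sum_{i=0}^{|V|}d(G,i)x^i$ and the total domination polynomial is $D_t(G,x)=\sum_{i=0}^{|V|}d_t(G,i)x^i$. -}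

module Defs where

open import Data.Nat as ℕ using (ℕ; zero; suc; NonZero)
open import Data.Nat.DivMod using (_mod_)
open import Data.Integer as ℤ using (ℤ; +_)
open import Data.Fin using (Fin; toℕ; _≟_)
open import Data.Fin.Properties using (all?; any?)
open import Data.Fin.Subset using (Subset; inside; outside; _∈_; _∉_; _⊆_; ∣_∣)
open import Data.Fin.Subset.Properties using (_∈?_; _⊆?_)
open import Data.List using (List; []; _∷_; _++_; map; filter; length; applyUpTo)
open import Data.Vec as Vec using ([]; _∷_)
open import Data.Product using (∃-syntax; _×_; _,_)
open import Relation.Nullary using (¬_; does; ¬?; _×-dec_; _→-dec_)
open import Relation.Unary as U using (Pred)
open import Relation.Binary using (Rel; Symmetric)
import Relation.Binary as B
open import Relation.Binary.PropositionalEquality using (_≡_; _≢_; refl; sym; trans; cong)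
open import Data.Nat.Properties using (*-comm)
open import Level using (0ℓ)

-- The list a₀ ∷ a₁ ∷ … ∷ aₖ ∷ [] stands for a₀ + a₁ x + … + aₖ xᵏ.
-- Trailing zeros are allowed, so polynomials are compared with _≈ₚ_, not _≡_.
Poly : Set
Poly = List ℤ

coeff : Poly → ℕ → ℤ
coeff []       _       = + 0
coeff (a ∷ _)  zero    = a
coeff (_ ∷ as) (suc k) = coeff as k

infix 4 _≈ₚ_
_≈ₚ_ : Rel Poly 0ℓ
P ≈ₚ Q = ∀ k → coeff P k ≡ coeff Q k

const : ℤ → Poly
const a = a ∷ []

X : Poly
X = + 0 ∷ + 1 ∷ []

infixl 6 _+ₚ_ _-ₚ_
infixl 7 _*ₚ_
infixr 8 _^ₚ_

_+ₚ_ : Poly → Poly → Poly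
[]       +ₚ Q        = Q
(a ∷ P)  +ₚ []       = a ∷ P
(a ∷ P)  +ₚ (b ∷ Q)  = a ℤ.+ b ∷ (P +ₚ Q)

_-ₚ_ : Poly → Poly → Poly
P -ₚ Q = P +ₚ map ℤ.-_ Q

-- (a + x P) Q = a Q + x (P Q)
_*ₚ_ : Poly → Poly → Poly
[]      *ₚ Q = []
(a ∷ P) *ₚ Q = map (a ℤ.*_) Q +ₚ (+ 0 ∷ (P *ₚ Q))

_^ₚ_ : Poly → ℕ → Poly
P ^ₚ zero  = const (+ 1)
P ^ₚ suc n = P *ₚ P ^ₚ n

comprehension : ∀ {N} {P : Pred (Fin N) 0ℓ} → U.Decidable P → Subset N
comprehension P? = Vec.tabulate (λ a → does (P? a))

-- Every subset of Fin N occurs exactly once.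
allSubsets : ∀ N → List (Subset N)
allSubsets zero    = [] ∷ []
allSubsets (suc N) = map (inside ∷_) (allSubsets N) ++ map (outside ∷_) (allSubsets N)

-- The vertex set is a subset V of an ambient finite set Fin N; elements of
-- Fin N outside V are not part of the graph.
record SimpleGraph (N : ℕ) : Set₁ where
  field
    V          : Subset N
    Adj        : Rel (Fin N) 0ℓ
    adj?       : B.Decidable Adj
    adj-∈      : ∀ {u v} → Adj u v → u ∈ V × v ∈ V
    adj-sym    : Symmetric Adj
    adj-irrefl : ∀ {v} → ¬ Adj v v

module _ {N : ℕ} (G : SimpleGraph N) where
  open SimpleGraph G

  IsDominating : Pred (Subset N) 0ℓ
  IsDominating S = S ⊆ V × (∀ v → v ∈ V → v ∉ S → ∃[ u ] (u ∈ S × Adj v u))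

  IsTotalDominating : Pred (Subset N) 0ℓ
  IsTotalDominating S = S ⊆ V × (∀ v → v ∈ V → ∃[ u ] (u ∈ S × Adj v u))

  isDominating? : U.Decidable IsDominating
  isDominating? S = (S ⊆? V) ×-dec all? λ v →
    (v ∈? V) →-dec ¬? (v ∈? S) →-dec any? (λ u → (u ∈? S) ×-dec adj? v u)

  isTotalDominating? : U.Decidable IsTotalDominating
  isTotalDominating? S = (S ⊆? V) ×-dec all? λ v →
    (v ∈? V) →-dec any? (λ u → (u ∈? S) ×-dec adj? v u)

  d : ℕ → ℕ
  d i = length (filter (λ S → isDominating? S ×-dec (∣ S ∣ ℕ.≟ i)) (allSubsets N))

  dₜ : ℕ → ℕ
  dₜ i = length (filter (λ S → isTotalDominating? S ×-dec (∣ S ∣ ℕ.≟ i)) (allSubsets N))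

  -- Coefficient lists of Σ_{i=0}^{|V|} d(G,i) xⁱ and Σ_{i=0}^{|V|} dₜ(G,i) xⁱ.
  D : Poly
  D = applyUpTo (λ i → + d i) (suc ∣ V ∣)

  Dₜ : Poly
  Dₜ = applyUpTo (λ i → + dₜ i) (suc ∣ V ∣)

-- Fin n is the set of residues of the ring ℤ/n.
module _ (n : ℕ) .{{_ : NonZero n}} where

  0ₙ : Fin n
  0ₙ = 0 mod n

  infixl 7 _*ₙ_
  _*ₙ_ : Fin n → Fin n → Fin n
  a *ₙ b = (toℕ a ℕ.* toℕ b) mod n

  IsZeroDivisor : Pred (Fin n) 0ℓ
  IsZeroDivisor a = ∃[ b ] (b ≢ 0ₙ × a *ₙ b ≡ 0ₙ)

  isZeroDivisor? : U.Decidable IsZeroDivisor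
  isZeroDivisor? a = any? λ b → ¬? (b ≟ 0ₙ) ×-dec (a *ₙ b ≟ 0ₙ)

  nonzeroZeroDivisors : Subset n
  nonzeroZeroDivisors = comprehension λ a → ¬? (a ≟ 0ₙ) ×-dec isZeroDivisor? a

  *ₙ-comm : ∀ a b → a *ₙ b ≡ b *ₙ a
  *ₙ-comm a b = cong (_mod n) (*-comm (toℕ a) (toℕ b))

  Γ : SimpleGraph n
  Γ = record
    { V          = W
    ; Adj        = λ u v → (u ∈ W × v ∈ W) × u ≢ v × u *ₙ v ≡ 0ₙ
    ; adj?       = λ u v → ((u ∈? W) ×-dec (v ∈? W)) ×-dec ¬? (u ≟ v) ×-dec (u *ₙ v ≟ 0ₙ)
    ; adj-∈      = λ (uv∈W , _) → uv∈W
    ; adj-sym    = λ {u} {v} ((u∈W , v∈W) , u≢v , uv≡0) →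
                     (v∈W , u∈W) , (λ v≡u → u≢v (sym v≡u)) , trans (*ₙ-comm v u) uv≡0
    ; adj-irrefl = λ (_ , v≢v , _) → v≢v refl
    }
    where W = nonzeroZeroDivisors

{-# OPTIONS --safe #-}
-- For a prime p, the nonzero zero-divisors of ℤ/p² are the nonzero multiples
-- of p, of which there are p − 1, and any two of them multiply to 0. Hence
-- Γ(ℤ/p²) is the complete graph on p − 1 vertices. In a nonempty complete graph
-- a set of vertices is dominating iff it is nonempty, and totally dominating
-- iff it has at least two elements; so the two polynomials are the binomial
-- expansion with the terms of degree < 1, respectively < 2, removed.
module Submission where

open import Data.Nat using (ℕ; _∸_; _^_)
open import Data.Nat.Properties using (m^n≢0)
open import Data.Nat.Primality using (Prime; prime⇒nonZero)
open import Data.Integer using (+_)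
open import Data.Product using (_×_)
open import Defs

open import Data.Nat
  using (zero; suc; _+_; _*_; _≤_; _<_; _≟_; z≤n; s≤s; NonZero; nonTrivial⇒n>1)
open import Data.Nat.Properties
  using (<⇒≱; n≮0; *-identityʳ; *-assoc; m<m*n; m<n⇒0<n∸m; suc-injective)
open import Data.Nat.DivMod using (_%_; _mod_; m<n⇒m%n≡m)
open import Data.Nat.Divisibility
  using (_∣_; _∤_; _∣?_; _∣0; ∣-refl; >⇒∤; *-pres-∣;
         *-cancelʳ-∣; m*n∣⇒n∣; ∣m+n∣m⇒∣n; ∣m∣n⇒∣m+n; m%n≡0⇒n∣m; n∣m⇒m%n≡0; divides-refl)
open import Data.Nat.Primality using (prime⇒nonTrivial; euclidsLemma)
open import Data.Nat.Combinatorics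
  using (_C_; k>n⇒nCk≡0; nC1≡n; nCk+nC[k+1]≡[n+1]C[k+1])
open import Data.Integer as ℤ using (ℤ)
import Data.Integer.Properties as ℤ
open import Data.Bool using (true; false)
open import Data.Fin as Fin using (Fin; zero; suc; toℕ)
open import Data.Fin.Properties using (any?; toℕ<n; toℕ-fromℕ<; toℕ-injective)
open import Data.Fin.Subset
  using (Subset; inside; outside; Nonempty; Empty; ⁅_⁆; _∈_; _⊆_; ∣_∣)
open import Data.Fin.Subset.Properties
  using (_∈?_; _⊆?_; out⊆; in⊆in; drop-∷-⊆; nonempty?; Empty-unique; ∣⊥∣≡0; ∣⁅x⁆∣≡1;
         x∈⁅x⁆; x∈⁅y⁆⇒x≡y; p⊆q⇒∣p∣≤∣q∣; p⊂q⇒∣p∣<∣q∣)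
open import Data.List using ([]; _∷_; _++_; map; filter; length; applyUpTo)
open import Data.List.Properties using (filter-++; filter-none; filter-≐; length-++)
import Data.List.Relation.Unary.All as All
open import Data.Vec using ([]; _∷_; here)
open import Data.Vec.Properties using (tabulate-cong; lookup∘tabulate; []=⇒lookup)
open import Data.Product using (∃-syntax; _,_; proj₁; proj₂)
open import Data.Sum using (inj₁; inj₂)
open import Function using (_∘_; case_of_; _⇔_; mk⇔; Equivalence)
open import Level using (0ℓ)
open import Relation.Nullary using (¬_; yes; no; does; contradiction; ¬?; _×-dec_)
open import Relation.Nullary.Decidable using (does-⇔; dec-true)
open import Relation.Unary using (Pred; Decidable; _≐_)
open import Relation.Binary.PropositionalEquality
  using (_≡_; _≢_; refl; sym; trans; cong; cong₂; subst; module ≡-Reasoning)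

open ≡-Reasoning

-- Coefficients of polynomials and the binomial expansion.

coeff-+ₚ : ∀ P Q k → coeff (P +ₚ Q) k ≡ coeff P k ℤ.+ coeff Q k
coeff-+ₚ []      Q       k       = sym (ℤ.+-identityˡ _)
coeff-+ₚ (a ∷ P) []      k       = sym (ℤ.+-identityʳ _)
coeff-+ₚ (a ∷ P) (b ∷ Q) zero    = refl
coeff-+ₚ (a ∷ P) (b ∷ Q) (suc k) = coeff-+ₚ P Q k

coeff-map : ∀ (f : ℤ → ℤ) → f (+ 0) ≡ + 0 → ∀ P k → coeff (map f P) k ≡ f (coeff P k)
coeff-map f f0 []      k       = sym f0
coeff-map f f0 (a ∷ P) zero    = refl
coeff-map f f0 (a ∷ P) (suc k) = coeff-map f f0 P k

coeff--ₚ : ∀ P Q k → coeff (P -ₚ Q) k ≡ coeff P k ℤ.- coeff Q k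
coeff--ₚ P Q k = trans (coeff-+ₚ P _ k) (cong (λ z → coeff P k ℤ.+ z) (coeff-map ℤ.-_ refl Q k))

-- The shift by `X` is left as a leading `+ 0`, so a single equation serves both `k = 0` and
-- `k > 0`, where the last term computes further.
coeff-∷-*ₚ : ∀ a P Q k →
  coeff ((a ∷ P) *ₚ Q) k ≡ a ℤ.* coeff Q k ℤ.+ coeff (+ 0 ∷ (P *ₚ Q)) k
coeff-∷-*ₚ a P Q k = trans (coeff-+ₚ (map (a ℤ.*_) Q) _ k)
  (cong (ℤ._+ coeff (+ 0 ∷ (P *ₚ Q)) k) (coeff-map (a ℤ.*_) (ℤ.*-zeroʳ a) Q k))

coeff-const-*ₚ : ∀ a Q k → coeff (const a *ₚ Q) k ≡ a ℤ.* coeff Q k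
coeff-const-*ₚ a Q zero    = trans (coeff-∷-*ₚ a [] Q zero) (ℤ.+-identityʳ _)
coeff-const-*ₚ a Q (suc k) = trans (coeff-∷-*ₚ a [] Q (suc k)) (ℤ.+-identityʳ _)

-- Multiplying by `1 + X` adds the coefficients at `suc k` and `k`, which is Pascal's rule.
coeff-[1+X]^ : ∀ n k → coeff ((const (+ 1) +ₚ X) ^ₚ n) k ≡ + (n C k)
coeff-[1+X]^ zero    zero    = refl
coeff-[1+X]^ zero    (suc k) = refl
coeff-[1+X]^ (suc n) zero    = begin
  coeff ((const (+ 1) +ₚ X) *ₚ B) 0        ≡⟨ coeff-∷-*ₚ (+ 1) (const (+ 1)) B 0 ⟩
  + 1 ℤ.* coeff B 0 ℤ.+ + 0                ≡⟨ cong (λ z → + 1 ℤ.* z ℤ.+ + 0) (coeff-[1+X]^ n 0) ⟩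
  + 1                                      ∎
  where B = (const (+ 1) +ₚ X) ^ₚ n
coeff-[1+X]^ (suc n) (suc k) = begin
  coeff ((const (+ 1) +ₚ X) *ₚ B) (suc k)
    ≡⟨ coeff-∷-*ₚ (+ 1) (const (+ 1)) B (suc k) ⟩
  + 1 ℤ.* coeff B (suc k) ℤ.+ coeff (const (+ 1) *ₚ B) k
    ≡⟨ cong₂ ℤ._+_ (ℤ.*-identityˡ (coeff B (suc k)))
         (trans (coeff-const-*ₚ (+ 1) B k) (ℤ.*-identityˡ (coeff B k))) ⟩
  coeff B (suc k) ℤ.+ coeff B k
    ≡⟨ cong₂ ℤ._+_ (coeff-[1+X]^ n (suc k)) (coeff-[1+X]^ n k) ⟩
  + (n C suc k) ℤ.+ + (n C k)
    ≡⟨ ℤ.+-comm (+ (n C suc k)) (+ (n C k)) ⟩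
  + (n C k + n C suc k)
    ≡⟨ cong +_ (nCk+nC[k+1]≡[n+1]C[k+1] n k) ⟩
  + (suc n C suc k) ∎
  where B = (const (+ 1) +ₚ X) ^ₚ n

-- Frees `D` and `Dₜ` from their cut-off at degree `∣ V ∣`: past the end of the list `coeff` returns
-- 0, so `f` has to vanish there.
coeff-applyUpTo : ∀ (f : ℕ → ℤ) n → (∀ k → n ≤ k → f k ≡ + 0) →
  ∀ k → coeff (applyUpTo f n) k ≡ f k
coeff-applyUpTo f zero    f≡0 k       = sym (f≡0 k z≤n)
coeff-applyUpTo f (suc n) f≡0 zero    = refl
coeff-applyUpTo f (suc n) f≡0 (suc k) =
  coeff-applyUpTo (f ∘ suc) n (λ k n≤k → f≡0 (suc k) (s≤s n≤k)) k

-- Counting subsets of a given size.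

length-filter-map : ∀ {A B : Set} {P : Pred B 0ℓ} (P? : Decidable P) (f : A → B) xs →
  length (filter P? (map f xs)) ≡ length (filter (P? ∘ f) xs)
length-filter-map P? f []       = refl
length-filter-map P? f (x ∷ xs) with does (P? (f x))
... | true  = cong suc (length-filter-map P? f xs)
... | false = length-filter-map P? f xs

length-filter-≐ : ∀ {A : Set} {P Q : Pred A 0ℓ} (P? : Decidable P) (Q? : Decidable Q) →
  P ≐ Q → ∀ xs → length (filter P? xs) ≡ length (filter Q? xs)
length-filter-≐ P? Q? P≐Q xs = cong length (filter-≐ P? Q? P≐Q xs)

length-filter-none : ∀ {A : Set} {P : Pred A 0ℓ} (P? : Decidable P) → (∀ x → ¬ P x) →
  ∀ xs → length (filter P? xs) ≡ 0
length-filter-none P? ¬P xs = cong length (filter-none P? (All.universal ¬P xs))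

filter-allSubsets-suc : ∀ {N} {P : Pred (Subset (suc N)) 0ℓ} (P? : Decidable P) →
  length (filter P? (allSubsets (suc N))) ≡
  length (filter (P? ∘ (inside ∷_)) (allSubsets N)) +
  length (filter (P? ∘ (outside ∷_)) (allSubsets N))
filter-allSubsets-suc {N} P? = begin
  length (filter P? (ins ++ outs))                 ≡⟨ cong length (filter-++ P? ins outs) ⟩
  length (filter P? ins ++ filter P? outs)         ≡⟨ length-++ (filter P? ins) ⟩
  length (filter P? ins) + length (filter P? outs)
    ≡⟨ cong₂ _+_ (length-filter-map P? (inside ∷_) (allSubsets N))
                 (length-filter-map P? (outside ∷_) (allSubsets N)) ⟩
  length (filter (P? ∘ (inside ∷_)) (allSubsets N)) +
  length (filter (P? ∘ (outside ∷_)) (allSubsets N)) ∎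
  where
  ins  = map (inside ∷_) (allSubsets N)
  outs = map (outside ∷_) (allSubsets N)

subsetOfSize? : ∀ {N} (V : Subset N) i → Decidable (λ S → S ⊆ V × ∣ S ∣ ≡ i)
subsetOfSize? V i S = (S ⊆? V) ×-dec (∣ S ∣ ≟ i)

outside∷-subsetOfSize : ∀ {N} s (V : Subset N) i →
  (λ S → outside ∷ S ⊆ s ∷ V × ∣ outside ∷ S ∣ ≡ i) ≐ (λ S → S ⊆ V × ∣ S ∣ ≡ i)
outside∷-subsetOfSize s V i =
    (λ { {S} (S⊆V , eq) → drop-∷-⊆ {s = outside} {p = S} {t = s} S⊆V , eq })
  , (λ { {S} (S⊆V , eq) → out⊆ {p = S} {s = s} S⊆V , eq })

inside∷-subsetOfSize : ∀ {N} (V : Subset N) i →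
  (λ S → inside ∷ S ⊆ inside ∷ V × ∣ inside ∷ S ∣ ≡ suc i) ≐ (λ S → S ⊆ V × ∣ S ∣ ≡ i)
inside∷-subsetOfSize V i =
    (λ { {S} (S⊆V , eq) → drop-∷-⊆ {s = inside} {p = S} {t = inside} S⊆V , suc-injective eq })
  , (λ { {S} (S⊆V , eq) → in⊆in {p = S} S⊆V , cong suc eq })

-- Induction on `V`, separating the sets that contain the first point from those that avoid it. If
-- the point is outside `V`, the first class is empty; if it is inside, the two classes are the two
-- summands of Pascal's rule.
count-subsetOfSize : ∀ {N} (V : Subset N) i →
  length (filter (subsetOfSize? V i) (allSubsets N)) ≡ ∣ V ∣ C i
count-outside∷-subsetOfSize : ∀ {N} s (V : Subset N) i →
  length (filter (subsetOfSize? (s ∷ V) i ∘ (outside ∷_)) (allSubsets N)) ≡ ∣ V ∣ C i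

count-subsetOfSize []            zero    = refl
count-subsetOfSize []            (suc i) = refl
count-subsetOfSize (outside ∷ V) i       = trans
  (filter-allSubsets-suc (subsetOfSize? (outside ∷ V) i))
  (cong₂ _+_
    (length-filter-none (subsetOfSize? (outside ∷ V) i ∘ (inside ∷_))
      (λ S (S⊆V , _) → case S⊆V here of λ ()) (allSubsets _))
    (count-outside∷-subsetOfSize outside V i))
count-subsetOfSize (inside ∷ V)  zero    = trans
  (filter-allSubsets-suc (subsetOfSize? (inside ∷ V) zero))
  (cong₂ _+_
    (length-filter-none (subsetOfSize? (inside ∷ V) zero ∘ (inside ∷_))
      (λ { S (_ , ()) }) (allSubsets _))
    (count-outside∷-subsetOfSize inside V zero))
count-subsetOfSize (inside ∷ V)  (suc i) = trans
  (filter-allSubsets-suc (subsetOfSize? (inside ∷ V) (suc i)))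
  (trans
    (cong₂ _+_
      (trans
        (length-filter-≐ (subsetOfSize? (inside ∷ V) (suc i) ∘ (inside ∷_)) (subsetOfSize? V i)
          (inside∷-subsetOfSize V i) (allSubsets _))
        (count-subsetOfSize V i))
      (count-outside∷-subsetOfSize inside V (suc i)))
    (nCk+nC[k+1]≡[n+1]C[k+1] ∣ V ∣ i))

count-outside∷-subsetOfSize s V i = trans
  (length-filter-≐ (subsetOfSize? (s ∷ V) i ∘ (outside ∷_)) (subsetOfSize? V i)
    (outside∷-subsetOfSize s V i) (allSubsets _))
  (count-subsetOfSize V i)

-- Subsets with at least one or at least two elements.

module _ {N : ℕ} {S : Subset N} where

  0<∣S∣⇒Nonempty : 0 < ∣ S ∣ → Nonempty S
  0<∣S∣⇒Nonempty 0<∣S∣ with nonempty? S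
  ... | yes ne = ne
  ... | no  ¬ne =
    contradiction (subst (0 <_) (trans (cong ∣_∣ (Empty-unique ¬ne)) (∣⊥∣≡0 N)) 0<∣S∣) n≮0

  ⁅x⁆⊆S : ∀ {x} → x ∈ S → ⁅ x ⁆ ⊆ S
  ⁅x⁆⊆S {x} x∈S y∈⁅x⁆ = subst (_∈ S) (sym (x∈⁅y⁆⇒x≡y x y∈⁅x⁆)) x∈S

  x∈S⇒0<∣S∣ : ∀ {x} → x ∈ S → 0 < ∣ S ∣
  x∈S⇒0<∣S∣ {x} x∈S = subst (_≤ ∣ S ∣) (∣⁅x⁆∣≡1 x) (p⊆q⇒∣p∣≤∣q∣ (⁅x⁆⊆S x∈S))

  x≢y∈S⇒1<∣S∣ : ∀ {x y} → x ∈ S → y ∈ S → x ≢ y → 1 < ∣ S ∣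
  x≢y∈S⇒1<∣S∣ {x} {y} x∈S y∈S x≢y = subst (_< ∣ S ∣) (∣⁅x⁆∣≡1 x)
    (p⊂q⇒∣p∣<∣q∣ (⁅x⁆⊆S x∈S , y , y∈S , λ y∈⁅x⁆ → x≢y (sym (x∈⁅y⁆⇒x≡y x y∈⁅x⁆))))

  -- Without such a `y`, `S` would lie in `⁅ x ⁆` and have at most one element. The point `x` is
  -- arbitrary because a total dominating set must serve vertices inside and outside itself.
  1<∣S∣⇒∃≢ : 1 < ∣ S ∣ → ∀ x → ∃[ y ] (y ∈ S × x ≢ y)
  1<∣S∣⇒∃≢ 1<∣S∣ x with any? (λ y → (y ∈? S) ×-dec ¬? (x Fin.≟ y))
  ... | yes other = other
  ... | no ¬other =
    contradiction (subst (∣ S ∣ ≤_) (∣⁅x⁆∣≡1 x) (p⊆q⇒∣p∣≤∣q∣ S⊆⁅x⁆)) (<⇒≱ 1<∣S∣)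
    where
    S⊆⁅x⁆ : S ⊆ ⁅ x ⁆
    S⊆⁅x⁆ {y} y∈S with x Fin.≟ y
    ... | yes refl = x∈⁅x⁆ x
    ... | no  x≢y  = contradiction (y , y∈S , x≢y) ¬other

-- Domination in nonempty complete graphs.

module _ {N : ℕ} (G : SimpleGraph N) where
  open SimpleGraph G

  IsComplete : Set
  IsComplete = ∀ {u v} → u ∈ V → v ∈ V → u ≢ v → Adj u v

module CompleteGraph {N : ℕ} (G : SimpleGraph N) (complete : IsComplete G)
  (V-nonempty : Nonempty (SimpleGraph.V G)) where
  open SimpleGraph G

  adj⇒≢ : ∀ {u v} → Adj u v → u ≢ v
  adj⇒≢ uv refl = adj-irrefl uv

  -- A fixed vertex of `V` is either in `S` or has a neighbour there, so `S` is nonempty.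
  -- Conversely, by completeness any one element of `S` is adjacent to every vertex outside `S`.
  dominating⇔ : ∀ S → IsDominating G S ⇔ (S ⊆ V × 0 < ∣ S ∣)
  dominating⇔ S = mk⇔ to from
    where
    to : IsDominating G S → S ⊆ V × 0 < ∣ S ∣
    to (S⊆V , dom) with proj₁ V-nonempty ∈? S
    ... | yes v∈S = S⊆V , x∈S⇒0<∣S∣ v∈S
    ... | no  v∉S = S⊆V , x∈S⇒0<∣S∣ (proj₁ (proj₂ (dom _ (proj₂ V-nonempty) v∉S)))

    from : S ⊆ V × 0 < ∣ S ∣ → IsDominating G S
    from (S⊆V , 0<∣S∣) = S⊆V , λ v v∈V v∉S →
      let (u , u∈S) = 0<∣S∣⇒Nonempty 0<∣S∣
      in u , u∈S , complete v∈V (S⊆V u∈S) (λ v≡u → v∉S (subst (_∈ S) (sym v≡u) u∈S))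

  -- Domination is applied twice: a vertex `v` has a neighbour `u` in `S`, and `u` has a neighbour
  -- `w` in `S`, distinct from `u` since there are no loops. Conversely, two elements of `S` always
  -- leave one different from the given vertex.
  totalDominating⇔ : ∀ S → IsTotalDominating G S ⇔ (S ⊆ V × 1 < ∣ S ∣)
  totalDominating⇔ S = mk⇔ to from
    where
    to : IsTotalDominating G S → S ⊆ V × 1 < ∣ S ∣
    to (S⊆V , dom) =
      let (v , v∈V)      = V-nonempty
          (u , u∈S , _)  = dom v v∈V
          (w , w∈S , uw) = dom u (S⊆V u∈S)
      in S⊆V , x≢y∈S⇒1<∣S∣ u∈S w∈S (adj⇒≢ uw)

    from : S ⊆ V × 1 < ∣ S ∣ → IsTotalDominating G S
    from (S⊆V , 1<∣S∣) = S⊆V , λ v v∈V →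
      let (u , u∈S , v≢u) = 1<∣S∣⇒∃≢ 1<∣S∣ v in u , u∈S , complete v∈V (S⊆V u∈S) v≢u

  module _ {P : Pred (Subset N) 0ℓ} (P? : Decidable P) {m : ℕ}
           (P⇔ : ∀ S → P S ⇔ (S ⊆ V × m < ∣ S ∣)) where
    open module P⇔ S = Equivalence (P⇔ S)

    -- With `m` equal to 0 for domination and 1 for total domination, this and the next count treat
    -- both polynomials at once.
    count-≤ : ∀ {i} → i ≤ m →
      length (filter (λ S → P? S ×-dec (∣ S ∣ ≟ i)) (allSubsets N)) ≡ 0
    count-≤ i≤m = length-filter-none _
      (λ { S (PS , refl) → <⇒≱ (proj₂ (P⇔.to S PS)) i≤m }) (allSubsets N)

    -- Once the size is fixed above `m`, the size bound in `P⇔` is automatic and only containment in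
    -- `V` is left to count.
    count-> : ∀ {i} → m < i →
      length (filter (λ S → P? S ×-dec (∣ S ∣ ≟ i)) (allSubsets N)) ≡ ∣ V ∣ C i
    count-> {i} m<i = trans
      (length-filter-≐ _ (subsetOfSize? V i)
        ( (λ { {S} (PS , eq) → proj₁ (P⇔.to S PS) , eq })
        , (λ { {S} (S⊆V , refl) → P⇔.from S (S⊆V , m<i) , refl }))
        (allSubsets N))
      (count-subsetOfSize V i)

  d-zero : d G 0 ≡ 0
  d-zero = count-≤ (isDominating? G) dominating⇔ z≤n

  d-suc : ∀ i → d G (suc i) ≡ ∣ V ∣ C suc i
  d-suc i = count-> (isDominating? G) dominating⇔ (s≤s z≤n)

  dₜ-zero : dₜ G 0 ≡ 0
  dₜ-zero = count-≤ (isTotalDominating? G) totalDominating⇔ z≤n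

  dₜ-one : dₜ G 1 ≡ 0
  dₜ-one = count-≤ (isTotalDominating? G) totalDominating⇔ (s≤s z≤n)

  dₜ-suc-suc : ∀ i → dₜ G (suc (suc i)) ≡ ∣ V ∣ C suc (suc i)
  dₜ-suc-suc i = count-> (isTotalDominating? G) totalDominating⇔ (s≤s (s≤s z≤n))

  coeff-D : ∀ k → coeff (D G) k ≡ + d G k
  coeff-D = coeff-applyUpTo (λ i → + d G i) (suc ∣ V ∣)
    -- Index 0 is excluded by `suc ∣ V ∣ ≤ k`; at the others the binomial coefficient vanishes.
    λ { (suc k) n<k → cong +_ (trans (d-suc k) (k>n⇒nCk≡0 n<k)) }

  coeff-Dₜ : ∀ k → coeff (Dₜ G) k ≡ + dₜ G k
  coeff-Dₜ = coeff-applyUpTo (λ i → + dₜ G i) (suc ∣ V ∣) vanish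
    where
    vanish : ∀ k → ∣ V ∣ < k → + dₜ G k ≡ + 0
    vanish (suc zero)    _   = cong +_ dₜ-one
    vanish (suc (suc k)) n<k = cong +_ (trans (dₜ-suc-suc k) (k>n⇒nCk≡0 n<k))

  D≈ : D G ≈ₚ (const (+ 1) +ₚ X) ^ₚ ∣ V ∣ -ₚ const (+ 1)
  D≈ k = begin
    coeff (D G) k                                      ≡⟨ coeff-D k ⟩
    + d G k                                            ≡⟨ counts k ⟩
    + (∣ V ∣ C k) ℤ.- coeff (const (+ 1)) k
      ≡⟨ cong (ℤ._- coeff (const (+ 1)) k) (coeff-[1+X]^ ∣ V ∣ k) ⟨
    coeff B k ℤ.- coeff (const (+ 1)) k                ≡⟨ coeff--ₚ B (const (+ 1)) k ⟨
    coeff (B -ₚ const (+ 1)) k                         ∎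
    where
    B = (const (+ 1) +ₚ X) ^ₚ ∣ V ∣
    counts : ∀ k → + d G k ≡ + (∣ V ∣ C k) ℤ.- coeff (const (+ 1)) k
    -- `∣ V ∣ C 0` computes to 1, which the subtracted constant cancels.
    counts zero    = cong +_ d-zero
    counts (suc k) = trans (cong +_ (d-suc k)) (sym (ℤ.+-identityʳ _))

  -- The constant cancels the binomial coefficient 1 in degree 0, the linear term cancels
  -- `∣ V ∣ C 1` in degree 1, and both corrections vanish from degree 2 on.
  Dₜ≈ : Dₜ G ≈ₚ (const (+ 1) +ₚ X) ^ₚ ∣ V ∣ -ₚ const (+ ∣ V ∣) *ₚ X -ₚ const (+ 1)
  Dₜ≈ k = begin
    coeff (Dₜ G) k                                     ≡⟨ coeff-Dₜ k ⟩
    + dₜ G k                                           ≡⟨ counts k ⟩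
    + (∣ V ∣ C k) ℤ.- + ∣ V ∣ ℤ.* coeff X k ℤ.- coeff (const (+ 1)) k
      ≡⟨ cong₂ (λ b l → b ℤ.- l ℤ.- coeff (const (+ 1)) k)
           (coeff-[1+X]^ ∣ V ∣ k) (coeff-const-*ₚ (+ ∣ V ∣) X k) ⟨
    coeff B k ℤ.- coeff L k ℤ.- coeff (const (+ 1)) k
      ≡⟨ cong (ℤ._- coeff (const (+ 1)) k) (coeff--ₚ B L k) ⟨
    coeff (B -ₚ L) k ℤ.- coeff (const (+ 1)) k         ≡⟨ coeff--ₚ (B -ₚ L) (const (+ 1)) k ⟨
    coeff (B -ₚ L -ₚ const (+ 1)) k                    ∎
    where
    B = (const (+ 1) +ₚ X) ^ₚ ∣ V ∣
    L = const (+ ∣ V ∣) *ₚ X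
    counts : ∀ k →
      + dₜ G k ≡ + (∣ V ∣ C k) ℤ.- + ∣ V ∣ ℤ.* coeff X k ℤ.- coeff (const (+ 1)) k
    counts zero = trans (cong +_ dₜ-zero)
      -- Only the product `+ ∣ V ∣ ℤ.* + 0` is stuck; everything else in degree 0 computes.
      (cong (λ l → + 1 ℤ.- l ℤ.- + 1) (sym (ℤ.*-zeroʳ (+ ∣ V ∣))))
    counts (suc zero) = sym (begin
      + (∣ V ∣ C 1) ℤ.- + ∣ V ∣ ℤ.* + 1 ℤ.- + 0  ≡⟨ ℤ.+-identityʳ _ ⟩
      + (∣ V ∣ C 1) ℤ.- + ∣ V ∣ ℤ.* + 1
        ≡⟨ cong₂ (λ c l → + c ℤ.- l) (nC1≡n ∣ V ∣) (ℤ.*-identityʳ (+ ∣ V ∣)) ⟩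
      + ∣ V ∣ ℤ.- + ∣ V ∣                         ≡⟨ ℤ.+-inverseʳ (+ ∣ V ∣) ⟩
      + 0                                        ≡⟨ cong +_ dₜ-one ⟨
      + dₜ G 1                                   ∎)
    counts (suc (suc k)) = sym (begin
      + c ℤ.- + ∣ V ∣ ℤ.* + 0 ℤ.- + 0  ≡⟨ ℤ.+-identityʳ _ ⟩
      + c ℤ.- + ∣ V ∣ ℤ.* + 0          ≡⟨ cong (λ l → + c ℤ.- l) (ℤ.*-zeroʳ (+ ∣ V ∣)) ⟩
      + c ℤ.- + 0                      ≡⟨ ℤ.+-identityʳ _ ⟩
      + c                              ≡⟨ cong +_ (dₜ-suc-suc k) ⟨
      + dₜ G (suc (suc k))             ∎)
      where c = ∣ V ∣ C suc (suc k)

-- Sizes of comprehensions and counting multiples.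

module _ {N : ℕ} {P : Pred (Fin N) 0ℓ} (P? : Decidable P) where

  ∈-comprehension⁻ : ∀ {a} → a ∈ comprehension P? → P a
  -- In the `no` case the equation would read `false ≡ true`, so only `yes` remains.
  ∈-comprehension⁻ {a} a∈ with P? a | trans (sym (lookup∘tabulate (does ∘ P?) a)) ([]=⇒lookup a∈)
  ... | yes Pa | _ = Pa

  comprehension-cong : ∀ {Q : Pred (Fin N) 0ℓ} (Q? : Decidable Q) → (∀ a → P a ⇔ Q a) →
    comprehension P? ≡ comprehension Q?
  comprehension-cong Q? P⇔Q = tabulate-cong λ a → does-⇔ (P⇔Q a) (P? a) (Q? a)

-- The predicate lives on `ℕ` rather than on `Fin` so that it can be shifted by `m` on the second
-- block; the induction shifts it by one at a time.
∣comprehension∣-+ : ∀ {P : Pred ℕ 0ℓ} (P? : Decidable P) m {n} →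
  ∣ comprehension {m + n} (P? ∘ toℕ) ∣ ≡
  ∣ comprehension {m} (P? ∘ toℕ) ∣ + ∣ comprehension {n} (λ a → P? (m + toℕ a)) ∣
∣comprehension∣-+ P? zero    = refl
∣comprehension∣-+ P? (suc m) with does (P? 0)
... | true  = cong suc (∣comprehension∣-+ (P? ∘ suc) m)
... | false = ∣comprehension∣-+ (P? ∘ suc) m

-- Only 0 counts: the other residues are positive and smaller than `p`.
∣multiples<p∣ : ∀ p .{{_ : NonZero p}} → ∣ comprehension {p} (λ a → p ∣? toℕ a) ∣ ≡ 1
∣multiples<p∣ p@(suc p-1) = trans
  (cong (λ b → ∣ b ∷ comprehension {p-1} (λ a → p ∣? suc (toℕ a)) ∣) (dec-true (p ∣? 0) (p ∣0)))
  (cong suc (trans (cong ∣_∣ (Empty-unique none)) (∣⊥∣≡0 p-1)))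
  where
  none : Empty (comprehension {p-1} (λ a → p ∣? suc (toℕ a)))
  none (a , a∈) = >⇒∤ (s≤s (toℕ<n a)) (∈-comprehension⁻ (λ a → p ∣? suc (toℕ a)) a∈)

-- `suc q * p` unfolds to `p + q * p`, so a block of length `p` splits off. It holds one multiple,
-- and shifting the rest by `p` preserves divisibility.
∣multiples<q*p∣ : ∀ p .{{_ : NonZero p}} q → ∣ comprehension {q * p} (λ a → p ∣? toℕ a) ∣ ≡ q
∣multiples<q*p∣ p zero    = refl
∣multiples<q*p∣ p (suc q) = trans (∣comprehension∣-+ (p ∣?_) p)
  (cong₂ _+_ (∣multiples<p∣ p)
    (trans
      (cong ∣_∣ (comprehension-cong (λ (a : Fin (q * p)) → p ∣? (p + toℕ a)) (λ a → p ∣? toℕ a)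
        (λ a → mk⇔ (λ p∣p+a → ∣m+n∣m⇒∣n p∣p+a ∣-refl) (∣m∣n⇒∣m+n ∣-refl))))
      (∣multiples<q*p∣ p q)))

-- For a successor modulus `0ₙ` computes to `zero`, so only the first bit changes, from true to
-- false.
∣nonzero∣ : ∀ n .{{_ : NonZero n}} {P : Pred (Fin n) 0ℓ} (P? : Decidable P) → P (0ₙ n) →
  ∣ comprehension (λ a → ¬? (a Fin.≟ 0ₙ n) ×-dec P? a) ∣ ≡ ∣ comprehension P? ∣ ∸ 1
∣nonzero∣ (suc n) P? P0 rewrite dec-true (P? zero) P0 = refl

-- Vanishing modulo `n` as divisibility.

module _ (n : ℕ) .{{_ : NonZero n}} where

  toℕ-0ₙ : toℕ (0ₙ n) ≡ 0
  toℕ-0ₙ = trans (toℕ-fromℕ< _) (n∣m⇒m%n≡0 0 n (n ∣0))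

  mod≡0ₙ⇔ : ∀ m → m mod n ≡ 0ₙ n ⇔ n ∣ m
  mod≡0ₙ⇔ m = mk⇔
    (λ eq → m%n≡0⇒n∣m m n (begin
      m % n          ≡⟨ toℕ-fromℕ< _ ⟨
      toℕ (m mod n)  ≡⟨ cong toℕ eq ⟩
      toℕ (0ₙ n)     ≡⟨ toℕ-0ₙ ⟩
      0              ∎))
    (λ n∣m → toℕ-injective (begin
      toℕ (m mod n)  ≡⟨ toℕ-fromℕ< _ ⟩
      m % n          ≡⟨ n∣m⇒m%n≡0 m n n∣m ⟩
      0              ≡⟨ toℕ-0ₙ ⟨
      toℕ (0ₙ n)     ∎))

  ∣toℕ⇒≡0ₙ : ∀ {a} → n ∣ toℕ a → a ≡ 0ₙ n
  ∣toℕ⇒≡0ₙ {a} n∣a = toℕ-injective (begin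
    toℕ a       ≡⟨ m<n⇒m%n≡m (toℕ<n a) ⟨
    toℕ a % n   ≡⟨ n∣m⇒m%n≡0 (toℕ a) n n∣a ⟩
    0           ≡⟨ toℕ-0ₙ ⟨
    toℕ (0ₙ n)  ∎)

-- Euclid's lemma is used twice: first `p` divides `n`, say `n = c * p`; cancelling one `p` leaves
-- `p ∣ m * c`, hence `p ∣ c`.
p*p∣m*n∧p∤m⇒p*p∣n : ∀ {p} → Prime p → ∀ m n → p * p ∣ m * n → p ∤ m → p * p ∣ n
p*p∣m*n∧p∤m⇒p*p∣n {p} p-prime m n pp∣mn p∤m with euclidsLemma m n p-prime (m*n∣⇒n∣ p p pp∣mn)
... | inj₁ p∣m                = contradiction p∣m p∤m
... | inj₂ (divides-refl c) with
        euclidsLemma m c p-prime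
          (*-cancelʳ-∣ p {{prime⇒nonZero p-prime}}
            (subst (p * p ∣_) (sym (*-assoc m c p)) pp∣mn))
...   | inj₁ p∣m = contradiction p∣m p∤m
...   | inj₂ p∣c = *-pres-∣ p∣c ∣-refl

-- The zero-divisor graph of ℤ/p².

module PrimeSquare (p : ℕ) (p-prime : Prime p) where

  instance
    p≢0 : NonZero p
    p≢0 = prime⇒nonZero p-prime

    p^2≢0 : NonZero (p ^ 2)
    p^2≢0 = m^n≢0 p 2

  p^2≡p*p : p ^ 2 ≡ p * p
  p^2≡p*p = cong (p *_) (*-identityʳ p)

  1<p : 1 < p
  1<p = nonTrivial⇒n>1 p {{prime⇒nonTrivial p-prime}}

  p<p^2 : p < p ^ 2
  p<p^2 = subst (p <_) (sym p^2≡p*p) (m<m*n p p 1<p)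

  -- If `p` does not divide `a`, then `a b = 0` forces `p * p` to divide `b`, so `b` is 0. The
  -- residue 0 satisfies both sides and is removed only when `V` is counted.
  zeroDivisor⇔ : ∀ a → IsZeroDivisor (p ^ 2) a ⇔ p ∣ toℕ a
  zeroDivisor⇔ a = mk⇔ to from
    where
    to : IsZeroDivisor (p ^ 2) a → p ∣ toℕ a
    to (b , b≢0 , ab≡0) with p ∣? toℕ a
    ... | yes p∣a = p∣a
    ... | no  p∤a = contradiction (∣toℕ⇒≡0ₙ (p ^ 2) (subst (_∣ toℕ b) (sym p^2≡p*p)
      (p*p∣m*n∧p∤m⇒p*p∣n p-prime (toℕ a) (toℕ b)
        (subst (_∣ toℕ a * toℕ b) p^2≡p*p (Equivalence.to (mod≡0ₙ⇔ (p ^ 2) _) ab≡0)) p∤a))) b≢0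

    p̄ : Fin (p ^ 2)
    p̄ = p mod (p ^ 2)

    toℕ-p̄ : toℕ p̄ ≡ p
    toℕ-p̄ = trans (toℕ-fromℕ< _) (m<n⇒m%n≡m p<p^2)

    from : p ∣ toℕ a → IsZeroDivisor (p ^ 2) a
    -- The residue of `p` annihilates every multiple of `p`, and it is nonzero because `p < p ^ 2`.
    from p∣a = p̄
      , (λ p̄≡0 → >⇒∤ p<p^2 (Equivalence.to (mod≡0ₙ⇔ (p ^ 2) p) p̄≡0))
      , Equivalence.from (mod≡0ₙ⇔ (p ^ 2) _)
          (subst (_∣ toℕ a * toℕ p̄) (sym p^2≡p*p)
            (*-pres-∣ p∣a (subst (p ∣_) (sym toℕ-p̄) ∣-refl)))

  G : SimpleGraph (p ^ 2)
  G = Γ (p ^ 2)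

  open SimpleGraph G using (V)

  ∈V⇒p∣ : ∀ {a} → a ∈ V → p ∣ toℕ a
  ∈V⇒p∣ {a} a∈V = Equivalence.to (zeroDivisor⇔ a) (proj₂ (∈-comprehension⁻ nonzeroZeroDivisor? a∈V))
    where
    -- Restates the decision procedure inside `nonzeroZeroDivisors`, to exhibit `V` as its
    -- comprehension.
    nonzeroZeroDivisor? : Decidable (λ a → a ≢ 0ₙ (p ^ 2) × IsZeroDivisor (p ^ 2) a)
    nonzeroZeroDivisor? a = ¬? (a Fin.≟ 0ₙ (p ^ 2)) ×-dec isZeroDivisor? (p ^ 2) a

  Γ-complete : IsComplete G
  Γ-complete {u} {v} u∈V v∈V u≢v = (u∈V , v∈V) , u≢v ,
    Equivalence.from (mod≡0ₙ⇔ (p ^ 2) _)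
      (subst (_∣ toℕ u * toℕ v) (sym p^2≡p*p) (*-pres-∣ (∈V⇒p∣ u∈V) (∈V⇒p∣ v∈V)))

  ∣V∣≡p∸1 : ∣ V ∣ ≡ p ∸ 1
  ∣V∣≡p∸1 = begin
    ∣ V ∣
      ≡⟨ ∣nonzero∣ (p ^ 2) (isZeroDivisor? (p ^ 2))
           (Equivalence.from (zeroDivisor⇔ (0ₙ (p ^ 2))) (subst (p ∣_) (sym (toℕ-0ₙ (p ^ 2))) (p ∣0))) ⟩
    ∣ comprehension (isZeroDivisor? (p ^ 2)) ∣ ∸ 1
      ≡⟨ cong (λ S → ∣ S ∣ ∸ 1)
           (comprehension-cong (isZeroDivisor? (p ^ 2)) (λ a → p ∣? toℕ a) zeroDivisor⇔) ⟩
    ∣ comprehension {p ^ 2} (λ a → p ∣? toℕ a) ∣ ∸ 1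
      -- The predicate sees `a` only through `toℕ`, so the ambient size can be replaced without
      -- transporting elements.
      ≡⟨ cong (λ n → ∣ comprehension {n} (λ a → p ∣? toℕ a) ∣ ∸ 1) p^2≡p*p ⟩
    ∣ comprehension {p * p} (λ a → p ∣? toℕ a) ∣ ∸ 1
      ≡⟨ cong (_∸ 1) (∣multiples<q*p∣ p p) ⟩
    p ∸ 1 ∎

  -- Since `1 < p`, the size `p ∸ 1` is positive; for `p = 2` the graph is a single vertex.
  V-nonempty : Nonempty V
  V-nonempty = 0<∣S∣⇒Nonempty (subst (0 <_) (sym ∣V∣≡p∸1) (m<n⇒0<n∸m 1<p))

  open CompleteGraph G Γ-complete V-nonempty public using (D≈; Dₜ≈)

theorem3p1 : (p : ℕ) (p-prime : Prime p) →
    let Γ[p²] = Γ (p ^ 2) {{m^n≢0 p 2 {{prime⇒nonZero p-prime}}}} in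
    (D Γ[p²] ≈ₚ (const (+ 1) +ₚ X) ^ₚ (p ∸ 1) -ₚ const (+ 1))
    × (Dₜ Γ[p²] ≈ₚ (const (+ 1) +ₚ X) ^ₚ (p ∸ 1) -ₚ const (+ (p ∸ 1)) *ₚ X -ₚ const (+ 1))
theorem3p1 p p-prime =
    subst (λ n → D G ≈ₚ (const (+ 1) +ₚ X) ^ₚ n -ₚ const (+ 1)) ∣V∣≡p∸1 D≈
  , subst (λ n → Dₜ G ≈ₚ (const (+ 1) +ₚ X) ^ₚ n -ₚ const (+ n) *ₚ X -ₚ const (+ 1)) ∣V∣≡p∸1 Dₜ≈
  where open PrimeSquare p p-prime
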